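{- For every pair of integers $n\ge 2$ and $1\le r\le n-1$, let $s:=\min\{r,n-r\}$. Then \[ \mathcal{K}^{\mathsf{TS}}(J(n,r))= \begin{cases} \{1\}, & n=2,\\ \{1,n-1\}, & n\ge 3\text{ and }s=1,\\ \{1,s\}, & s\ge 2\text{ and }n=2s,\\ \{1,s,n-s\}, & s\ge 2\text{ and }n>2s. \end{cases} \]
   Context: All graphs are finite, simple, undirected. A clique of a graph $H$ is a set of pairwise adjacent vertices; a $k$-clique is a clique with $k$ vertices. For a graph $H$ and integer $k\ge1$, the Token Sliding graph $\mathsf{TS}_k(H)$ has as vertices the $k$-cliques of $H$, and two $k$-cliques $A,B$ are adjacent iff $A\setminus B=\{u\}$, $B\setminus A=\{v\}$ for some vertices $u,v$ with $uv\in E(H)$. For a graph $G$, $\mathcal{K}^{\mathsf{TS}}(G)=\{k\ge1:\ \exists\text{ a graph }H\text{ with }\mathsf{TS}_k(H)\cong G\}$. The Johnson graph $J(n,r)$ has as vertices the $r$-subsets of $\{1,\dots,n\}$, two being adjacent iff their intersection has size $r-1$. -}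

module Defs where

open import Data.Fin.Base using (Fin)
open import Data.Fin.Properties using (any?)
open import Data.Fin.Subset using (Subset; _∈_; _∩_; _─_; ⁅_⁆; ∣_∣)
open import Data.Fin.Subset.Properties using (x∈⁅x⁆; x∈⁅y⁆⇒x≡y; ∩-comm; ∩-idem)
open import Data.Bool.Properties using () renaming (_≟_ to _≟ᵇ_)
open import Data.Irrelevant using ([_])
open import Data.Nat.Base using (ℕ; suc; _≤_)
open import Data.Nat.Properties using (_≟_; 1+n≢n)
open import Data.Product.Base using (_×_; _,_; ∃-syntax)
open import Data.Refinement using (Refinement-syntax; value; _,_)
open import Data.Vec.Properties using (≡-dec)
open import Function.Base using (_∘_)
open import Function.Bundles using (_↔_; _⇔_; Inverse)
open import Level using (0ℓ) renaming (suc to lsuc)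
open import Relation.Binary.Core using (Rel)
open import Relation.Binary.Definitions using (Decidable; Symmetric)
open import Relation.Binary.PropositionalEquality
  using (_≡_; _≢_; refl; sym; trans; cong; subst)
open import Relation.Nullary.Decidable using (_×-dec_; recompute)
open import Relation.Nullary.Negation using (¬_)
open import Relation.Unary using (Pred)

-- A finite graph is a `SimpleGraph (Fin m)`. The vertex type is a parameter so
-- that graphs whose vertices are sets need no numbering of their vertices.
-- Decidability of adjacency is automatic classically for a finite graph.
record SimpleGraph (V : Set) : Set₁ where
  field
    Adj        : Rel V 0ℓ
    adj?       : Decidable Adj
    adj-sym    : Symmetric Adj
    adj-irrefl : ∀ x → ¬ Adj x x

open SimpleGraph

record _≅_ {V W : Set} (G : SimpleGraph V) (H : SimpleGraph W) : Set where
  field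
    bijection : V ↔ W
    adj⇔      : ∀ x y → Adj G x y ⇔ Adj H (Inverse.to bijection x) (Inverse.to bijection y)

infix 4 _≅_

IsClique : ∀ {m} → SimpleGraph (Fin m) → Subset m → Set
IsClique H S = ∀ x y → x ∈ S → y ∈ S → x ≢ y → Adj H x y

-- The membership proofs in `KClique` and `KSubset` are irrelevant, so two
-- elements are equal as soon as their underlying subsets are.
KClique : ∀ {m} → SimpleGraph (Fin m) → ℕ → Set
KClique {m} H k = [ S ∈ Subset m ∣ IsClique H S × ∣ S ∣ ≡ k ]

KSubset : ℕ → ℕ → Set
KSubset n k = [ S ∈ Subset n ∣ ∣ S ∣ ≡ k ]

TS : ∀ {m} (k : ℕ) (H : SimpleGraph (Fin m)) → SimpleGraph (KClique H k)
TS {m} k H = record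
  { Adj        = λ A B → Slide (value A) (value B)
  ; adj?       = λ A B → slide? (value A) (value B)
  ; adj-sym    = λ (u , v , p , q , e) → v , u , q , p , adj-sym H e
  ; adj-irrefl = λ A → irrefl (value A)
  }
  where
  Slide : Rel (Subset m) 0ℓ
  Slide A B = ∃[ u ] ∃[ v ] A ─ B ≡ ⁅ u ⁆ × B ─ A ≡ ⁅ v ⁆ × Adj H u v

  slide? : Decidable Slide
  slide? A B = any? λ u → any? λ v →
    ≡-dec _≟ᵇ_ (A ─ B) ⁅ u ⁆ ×-dec ≡-dec _≟ᵇ_ (B ─ A) ⁅ v ⁆ ×-dec adj? H u v

  irrefl : ∀ A → ¬ Slide A A
  irrefl A (u , v , p , q , e) = adj-irrefl H v (subst (λ w → Adj H w v) u≡v e)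
    where
    u≡v : u ≡ v
    u≡v = x∈⁅y⁆⇒x≡y v (subst (u ∈_) (trans (sym p) q) (x∈⁅x⁆ u))

-- `suc ∣ A ∩ B ∣ ≡ r` says ∣ A ∩ B ∣ = r - 1 without truncated subtraction,
-- which would make the single vertex of J(n,0) a loop.
Johnson : (n r : ℕ) → SimpleGraph (KSubset n r)
Johnson n r = record
  { Adj        = λ A B → suc ∣ value A ∩ value B ∣ ≡ r
  ; adj?       = λ A B → suc ∣ value A ∩ value B ∣ ≟ r
  ; adj-sym    = λ {A} {B} e → trans (cong (suc ∘ ∣_∣) (∩-comm (value B) (value A))) e
  ; adj-irrefl = irrefl
  }
  where
  irrefl : (A : KSubset n r) → ¬ suc ∣ value A ∩ value A ∣ ≡ r
  irrefl A e = 1+n≢n (trans (cong suc (sym (cong ∣_∣ (∩-idem (value A))))) (trans e (sym (size A))))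
    where
    size : (A : KSubset n r) → ∣ value A ∣ ≡ r
    size (S , [ p ]) = recompute (∣ S ∣ ≟ r) p

𝒦ᵀˢ : {V : Set} → SimpleGraph V → Pred ℕ (lsuc 0ℓ)
𝒦ᵀˢ G k = 1 ≤ k × ∃[ m ] ∃[ H ] TS {m} k H ≅ G

{-# OPTIONS --safe #-}
module Submission where

-- J(n,r) is TS_r(K_n), and complementation identifies it with TS_{n-r}(K_n). Conversely, let k ≥ 2
-- and TS_k(H) ≅ J(n,r). The two ends of an edge of TS_k(H) span a (k+1)-clique Q of H, and deleting
-- three different vertices of Q in turn gives a "flat" triangle A, B, X, that is, one with X ⊆ A ∪ B.
-- The k-cliques equal or adjacent to each of A, B, X are exactly the k + 1 sets Q - q, so an
-- isomorphism of token sliding graphs TS_k and TS_l taking a flat triangle to a flat one forces k = l.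
-- A triangle A, B, X of r-sets is flat or satisfies A ∩ B ⊆ X, in which case the complements form a
-- flat triangle of (n-r)-sets; hence k = r or k = n - r.

open import Defs
open import Data.Fin.Base using (Fin; zero; suc)
open import Data.Fin.Properties using (+↔⊎) renaming (_≟_ to _≟ᶠ_; suc-injective to sucᶠ-injective)
open import Data.Fin.Subset
  using (Subset; inside; outside; _∈_; _∉_; _⊆_; _∩_; _─_; _-_; ⁅_⁆; ∁; ∣_∣; Nonempty; ⊥)
  renaming (_∪_ to _∪ˢ_)
open import Data.Fin.Subset.Properties
open import Data.Irrelevant using ([_])
open import Data.Nat.Base using (ℕ; zero; suc; _+_; _≤_; _<_; _∸_; _*_; _⊓_; z≤n; s≤s; s≤s⁻¹)
open import Data.Nat.Properties
open import Data.Product.Base using (_×_; _,_; proj₁; proj₂; ∃-syntax)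
open import Data.Refinement using (Refinement; Refinement-syntax; value; _,_; value-injective)
open import Data.Sum.Base using (_⊎_; inj₁; inj₂; [_,_]′; swap) renaming (map to ⊎-map)
open import Data.Sum.Function.Propositional using (_⊎-↔_)
open import Data.Vec.Base using ([]; _∷_; here; there)
open import Function.Base using (_∘_; id)
open import Function.Bundles using (_↔_; _⇔_; Inverse; Equivalence; mk↔ₛ′; mk⇔)
open import Function.Construct.Composition using (_↔-∘_; _⇔-∘_)
open import Function.Construct.Symmetry using (↔-sym)
open import Level using (0ℓ)
open import Relation.Binary.PropositionalEquality
open import Relation.Nullary.Decidable using (yes; no; ¬?; recompute; decidable-stable)
open import Relation.Nullary.Negation using (contradiction; contradiction-irr)
open import Relation.Unary using (Pred; Decidable; _≐_; _∪_; ｛_｝)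

open SimpleGraph
open _≅_

-- Finite subsets

private variable
  m n k l : ℕ
  x u v : Fin n
  A B D Q S : Subset n

x∈p─q⇒x∉q : x ∈ A ─ B → x ∉ B
x∈p─q⇒x∉q {A = _ ∷ _} {B = outside ∷ _} (there x∈) (there x∈B) = x∈p─q⇒x∉q x∈ x∈B
x∈p─q⇒x∉q {A = _ ∷ _} {B = inside  ∷ _} (there x∈) (there x∈B) = x∈p─q⇒x∉q x∈ x∈B

p─q≡⁅u⁆⁺ : u ∈ A → u ∉ B → (∀ {x} → x ∈ A → x ∉ B → x ≡ u) → A ─ B ≡ ⁅ u ⁆
p─q≡⁅u⁆⁺ {u = u} {A} {B} u∈A u∉B unique = ⊆-antisym
  (λ x∈ → subst (_∈ ⁅ u ⁆) (sym (unique (p─q⊆p A B x∈) (x∈p─q⇒x∉q x∈))) (x∈⁅x⁆ u))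
  (λ x∈ → subst (_∈ A ─ B) (sym (x∈⁅y⁆⇒x≡y u x∈)) (x∈p∧x∉q⇒x∈p─q u∈A u∉B))

module _ {A B : Subset n} {u : Fin n} (A─B≡⁅u⁆ : A ─ B ≡ ⁅ u ⁆) where

  private
    u∈A─B : u ∈ A ─ B
    u∈A─B = subst (u ∈_) (sym A─B≡⁅u⁆) (x∈⁅x⁆ u)

  p─q≡⁅u⁆⇒u∈p : u ∈ A
  p─q≡⁅u⁆⇒u∈p = p─q⊆p A B u∈A─B

  p─q≡⁅u⁆⇒u∉q : u ∉ B
  p─q≡⁅u⁆⇒u∉q = x∈p─q⇒x∉q u∈A─B

  p─q≡⁅u⁆⇒unique : x ∈ A → x ∉ B → x ≡ u
  p─q≡⁅u⁆⇒unique x∈A x∉B = x∈⁅y⁆⇒x≡y u (subst (_ ∈_) A─B≡⁅u⁆ (x∈p∧x∉q⇒x∈p─q x∈A x∉B))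

  p─q≡⁅u⁆⇒x≢u⇒x∈q : x ∈ A → x ≢ u → x ∈ B
  p─q≡⁅u⁆⇒x≢u⇒x∈q {x} x∈A x≢u with x ∈? B
  ... | yes x∈B = x∈B
  ... | no  x∉B = contradiction (p─q≡⁅u⁆⇒unique x∈A x∉B) x≢u

∣p─q∣+∣p∩q∣≡∣p∣ : (A B : Subset n) → ∣ A ─ B ∣ + ∣ A ∩ B ∣ ≡ ∣ A ∣
∣p─q∣+∣p∩q∣≡∣p∣ []            []            = refl
∣p─q∣+∣p∩q∣≡∣p∣ (inside  ∷ A) (inside  ∷ B) =
  trans (+-suc ∣ A ─ B ∣ ∣ A ∩ B ∣) (cong suc (∣p─q∣+∣p∩q∣≡∣p∣ A B))
∣p─q∣+∣p∩q∣≡∣p∣ (inside  ∷ A) (outside ∷ B) = cong suc (∣p─q∣+∣p∩q∣≡∣p∣ A B)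
∣p─q∣+∣p∩q∣≡∣p∣ (outside ∷ A) (inside  ∷ B) = ∣p─q∣+∣p∩q∣≡∣p∣ A B
∣p─q∣+∣p∩q∣≡∣p∣ (outside ∷ A) (outside ∷ B) = ∣p─q∣+∣p∩q∣≡∣p∣ A B

∣p∣≡1+k⇒Nonempty : (S : Subset n) → ∣ S ∣ ≡ suc k → Nonempty S
∣p∣≡1+k⇒Nonempty {n} S eq with nonempty? S
... | yes x∈S = x∈S
... | no  ∄x  =
  contradiction (trans (sym (∣⊥∣≡0 n)) (trans (cong ∣_∣ (sym (Empty-unique ∄x))) eq)) 0≢1+n

x∈p⇒∣p∣≡1+∣p-x∣ : x ∈ S → ∣ S ∣ ≡ suc ∣ S - x ∣
x∈p⇒∣p∣≡1+∣p-x∣ {S = inside  ∷ S} here        = cong (suc ∘ ∣_∣) (sym (p─⊥≡p S))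
x∈p⇒∣p∣≡1+∣p-x∣ {S = inside  ∷ S} (there x∈S) = cong suc (x∈p⇒∣p∣≡1+∣p-x∣ x∈S)
x∈p⇒∣p∣≡1+∣p-x∣ {S = outside ∷ S} (there x∈S) = x∈p⇒∣p∣≡1+∣p-x∣ x∈S

x∉p-x : (S : Subset n) (x : Fin n) → x ∉ S - x
x∉p-x S x x∈ = x∈p─q⇒x∉q x∈ (x∈⁅x⁆ x)

∣p∣≡1⇒singleton : (S : Subset n) → ∣ S ∣ ≡ 1 → ∃[ x ] S ≡ ⁅ x ⁆
∣p∣≡1⇒singleton {n} S eq with x , x∈S ← ∣p∣≡1+k⇒Nonempty S eq = x , ⊆-antisym
  (λ {y} y∈S → decidable-stable (y ∈? ⁅ x ⁆) λ y∉ →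
    contradiction (trans (sym eq) (x∈p⇒∣p∣≡1+∣p-x∣ x∈S))
      (<⇒≢ (s≤s (subst (1 ≤_) (sym (x∈p⇒∣p∣≡1+∣p-x∣ (x∈p∧x∉q⇒x∈p─q y∈S y∉))) (s≤s z≤n)))))
  (λ y∈ → subst (_∈ S) (sym (x∈⁅y⁆⇒x≡y x y∈)) x∈S)

p⊆q⇒q∩p≡p : A ⊆ B → B ∩ A ≡ A
p⊆q⇒q∩p≡p {A = A} {B = B} A⊆B = ⊆-antisym (p∩q⊆q B A) (λ x∈A → x∈p∩q⁺ (A⊆B x∈A , x∈A))

-- Here `Q ∩ D` is `D`, so splitting `Q` into `Q ─ D` and `Q ∩ D` leaves exactly one element for
-- `Q ─ D`.
p⊆q∧∣q∣≡1+∣p∣⇒p≡q-x : D ⊆ Q → ∣ Q ∣ ≡ suc ∣ D ∣ → ∃[ q ] q ∈ Q × D ≡ Q - q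
p⊆q∧∣q∣≡1+∣p∣⇒p≡q-x {D = D} {Q = Q} D⊆Q eq
  with q , Q─D≡⁅q⁆ ← ∣p∣≡1⇒singleton (Q ─ D) (+-cancelʳ-≡ ∣ D ∣ ∣ Q ─ D ∣ 1
         (trans (cong (λ S → ∣ Q ─ D ∣ + ∣ S ∣) (sym (p⊆q⇒q∩p≡p D⊆Q))) (trans (∣p─q∣+∣p∩q∣≡∣p∣ Q D) eq)))
  = q , p─q≡⁅u⁆⇒u∈p Q─D≡⁅q⁆ , ⊆-antisym
      (λ x∈D → x∈p∧x≢y⇒x∈p-y (D⊆Q x∈D) λ { refl → p─q≡⁅u⁆⇒u∉q Q─D≡⁅q⁆ x∈D })
      (λ {x} x∈ → p─q≡⁅u⁆⇒x≢u⇒x∈q Q─D≡⁅q⁆ (p─q⊆p Q ⁅ q ⁆ x∈) λ { refl → x∉p-x Q x x∈ })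

p-x─p-y≡⁅y⁆ : {p q : Fin n} → q ∈ Q → p ≢ q → (Q - p) ─ (Q - q) ≡ ⁅ q ⁆
p-x─p-y≡⁅y⁆ {Q = Q} {p} {q} q∈Q p≢q =
  p─q≡⁅u⁆⁺ (x∈p∧x≢y⇒x∈p-y q∈Q (p≢q ∘ sym)) (x∉p-x Q q) λ {x} x∈ x∉ →
    decidable-stable (x ≟ᶠ q) λ x≢q → x∉ (x∈p∧x≢y⇒x∈p-y (p─q⊆p Q ⁅ p ⁆ x∈) x≢q)

-- Pigeonhole, by induction on `S`: the partner of the first element is deleted from `T`, and
-- injectivity keeps the partners of later elements away from it. `R` may relate one `x` to several
-- `y`.
relation⇒∣p∣≤∣q∣ : (S : Subset m) (T : Subset n) (R : Fin m → Fin n → Set) →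
  (∀ {x} → x ∈ S → ∃[ y ] y ∈ T × R x y) →
  (∀ {x x′ y} → R x y → R x′ y → x ≡ x′) → ∣ S ∣ ≤ ∣ T ∣
relation⇒∣p∣≤∣q∣ []            T R total inj = z≤n
relation⇒∣p∣≤∣q∣ (outside ∷ S) T R total inj = relation⇒∣p∣≤∣q∣ S T (R ∘ suc)
  (total ∘ there) (λ r r′ → sucᶠ-injective (inj r r′))
relation⇒∣p∣≤∣q∣ (inside  ∷ S) T R total inj with y₀ , y₀∈T , r₀ ← total here =
  subst (suc ∣ S ∣ ≤_) (sym (x∈p⇒∣p∣≡1+∣p-x∣ y₀∈T)) (s≤s (relation⇒∣p∣≤∣q∣ S (T - y₀) (R ∘ suc)
    (λ x∈S → let y , y∈T , r = total (there x∈S) in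
      y , x∈p∧x≢y⇒x∈p-y y∈T (λ { refl → contradiction (inj r₀ r) λ () }) , r)
    (λ r r′ → sucᶠ-injective (inj r r′))))

∃-∣p∣≡k : k ≤ n → ∃[ S ] ∣_∣ {n} S ≡ k
∃-∣p∣≡k {n = n} z≤n = ⊥ , ∣⊥∣≡0 n
∃-∣p∣≡k (s≤s k≤n) with S , eq ← ∃-∣p∣≡k k≤n = inside ∷ S , cong suc eq

∁-involutive : (S : Subset n) → ∁ (∁ S) ≡ S
∁-involutive []            = refl
∁-involutive (inside  ∷ S) = cong (inside ∷_) (∁-involutive S)
∁-involutive (outside ∷ S) = cong (outside ∷_) (∁-involutive S)

∁p─∁q≡q─p : (A B : Subset n) → ∁ A ─ ∁ B ≡ B ─ A
∁p─∁q≡q─p []            []            = refl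
∁p─∁q≡q─p (inside  ∷ A) (inside  ∷ B) = cong (_ ∷_) (∁p─∁q≡q─p A B)
∁p─∁q≡q─p (inside  ∷ A) (outside ∷ B) = cong (_ ∷_) (∁p─∁q≡q─p A B)
∁p─∁q≡q─p (outside ∷ A) (inside  ∷ B) = cong (_ ∷_) (∁p─∁q≡q─p A B)
∁p─∁q≡q─p (outside ∷ A) (outside ∷ B) = cong (_ ∷_) (∁p─∁q≡q─p A B)

-- Numbers the vertices of `Johnson n r`, so that this graph can itself serve as `H` when `k = 1`.
-- The induction splits the subsets by whether they contain the first element.
subsets-finite : {P : Pred (Subset n) 0ℓ} → Decidable P → ∃[ m ] Refinement (Subset n) P ↔ Fin m
subsets-finite {zero} P? with P? []
... | yes p = 1 , mk↔ₛ′ (λ _ → zero) (λ _ → [] , [ p ]) (λ { zero → refl }) (λ { ([] , _) → refl })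
... | no ¬p = 0 , mk↔ₛ′ (λ { ([] , [ p ]) → contradiction-irr p ¬p }) (λ ())
                        (λ ()) (λ { ([] , [ p ]) → contradiction-irr p ¬p })
subsets-finite {suc n} {P} P?
  with i , f ← subsets-finite (P? ∘ (inside ∷_)) | o , g ← subsets-finite (P? ∘ (outside ∷_))
  = i + o , ↔-sym +↔⊎ ↔-∘ ((f ⊎-↔ g) ↔-∘ split)
  where
  split : Refinement (Subset (suc n)) P ↔
          (Refinement (Subset n) (P ∘ (inside ∷_)) ⊎ Refinement (Subset n) (P ∘ (outside ∷_)))
  split = mk↔ₛ′
    (λ { (inside ∷ S , p) → inj₁ (S , p) ; (outside ∷ S , p) → inj₂ (S , p) })
    (λ { (inj₁ (S , p)) → inside ∷ S , p ; (inj₂ (S , p)) → outside ∷ S , p })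
    (λ { (inj₁ _) → refl ; (inj₂ _) → refl })
    (λ { (inside ∷ S , p) → refl ; (outside ∷ S , p) → refl })

-- Graphs

module _ {V W : Set} {G : SimpleGraph V} {H : SimpleGraph W} where

  to : G ≅ H → V → W
  to φ = Inverse.to (bijection φ)

  from : G ≅ H → W → V
  from φ = Inverse.from (bijection φ)

  to∘from : (φ : G ≅ H) (w : W) → to φ (from φ w) ≡ w
  to∘from φ = Inverse.strictlyInverseˡ (bijection φ)

  from∘to : (φ : G ≅ H) (v : V) → from φ (to φ v) ≡ v
  from∘to φ = Inverse.strictlyInverseʳ (bijection φ)

  to-adj : (φ : G ≅ H) {x y : V} → Adj G x y → Adj H (to φ x) (to φ y)
  to-adj φ {x} {y} = Equivalence.to (adj⇔ φ x y)

  ≅-sym : G ≅ H → H ≅ G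
  ≅-sym φ = record
    { bijection = ↔-sym (bijection φ)
    ; adj⇔      = λ x y → mk⇔
        (λ e → Equivalence.from (adj⇔ φ _ _) (subst₂ (Adj H) (sym (to∘from φ x)) (sym (to∘from φ y)) e))
        (λ e → subst₂ (Adj H) (to∘from φ x) (to∘from φ y) (to-adj φ e))
    }

≅-trans : {U V W : Set} {F : SimpleGraph U} {G : SimpleGraph V} {H : SimpleGraph W} →
          F ≅ G → G ≅ H → F ≅ H
≅-trans φ ψ = record
  { bijection = bijection ψ ↔-∘ bijection φ
  ; adj⇔      = λ x y → adj⇔ ψ (to φ x) (to φ y) ⇔-∘ adj⇔ φ x y
  }

-- The closed neighbourhood relation: with it, all `k`-subsets of a `(k+1)`-clique are related to
-- each other, each one to itself included.
Near : {V : Set} → SimpleGraph V → V → V → Set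
Near G x y = x ≡ y ⊎ Adj G x y

Triangle : {V : Set} → SimpleGraph V → V → V → V → Set
Triangle G x y z = Adj G x y × Adj G x z × Adj G y z

complete : (n : ℕ) → SimpleGraph (Fin n)
complete n = record
  { Adj        = _≢_
  ; adj?       = λ x y → ¬? (x ≟ᶠ y)
  ; adj-sym    = ≢-sym
  ; adj-irrefl = λ x x≢x → x≢x refl
  }

-- Token sliding graphs

-- Two vertices within `A` or within `B` are adjacent because these are cliques. As both differences
-- are singletons, the only pair left is `u`, `v`.
IsClique-∪ : (H : SimpleGraph (Fin m)) → IsClique H A → IsClique H B →
  A ─ B ≡ ⁅ u ⁆ → B ─ A ≡ ⁅ v ⁆ → Adj H u v → IsClique H (A ∪ˢ B)
IsClique-∪ {A = A} {B = B} H A-clique B-clique A─B B─A u~v x y x∈ y∈ x≢y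
  with x ∈? A | x ∈? B | y ∈? A | y ∈? B
... | yes x∈A | _       | yes y∈A | _       = A-clique x y x∈A y∈A x≢y
... | _       | yes x∈B | _       | yes y∈B = B-clique x y x∈B y∈B x≢y
... | no  x∉A | no  x∉B | _       | _       = contradiction (x∈p∪q⁻ A B x∈) [ x∉A , x∉B ]′
... | _       | _       | no  y∉A | no  y∉B = contradiction (x∈p∪q⁻ A B y∈) [ y∉A , y∉B ]′
... | yes x∈A | no  x∉B | no  y∉A | yes y∈B = subst₂ (Adj H)
  (sym (p─q≡⁅u⁆⇒unique A─B x∈A x∉B)) (sym (p─q≡⁅u⁆⇒unique B─A y∈B y∉A)) u~v
... | no  x∉A | yes x∈B | yes y∈A | no  y∉B = adj-sym H (subst₂ (Adj H)
  (sym (p─q≡⁅u⁆⇒unique A─B y∈A y∉B)) (sym (p─q≡⁅u⁆⇒unique B─A x∈B x∉A)) u~v)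

size : {P : Pred (Subset n) 0ℓ} (A : [ S ∈ Subset n ∣ P S × ∣ S ∣ ≡ k ]) → ∣ value A ∣ ≡ k
size {k = k} (S , [ p ]) = recompute (∣ S ∣ ≟ k) (proj₂ p)

module _ {k : ℕ} (H : SimpleGraph (Fin m)) where

  -- The clique proofs inside `A` and `B` are irrelevant; decidability of adjacency turns what
  -- follows from them into a usable proof.
  ∪-clique : (A B : KClique H k) → Adj (TS k H) A B → IsClique H (value A ∪ˢ value B)
  ∪-clique (A , [ p ]) (B , [ q ]) (u , v , A─B , B─A , u~v) x y x∈ y∈ x≢y =
    recompute (adj? H x y) (IsClique-∪ H (proj₁ p) (proj₁ q) A─B B─A u~v x y x∈ y∈ x≢y)

  -- The union adds the single vertex `v` to `A`, so deleting `v` gives back `A`.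
  ∪-size : (A B : KClique H k) → Adj (TS k H) A B → ∣ value A ∪ˢ value B ∣ ≡ suc k
  ∪-size A B (u , v , A─B≡⁅u⁆ , B─A≡⁅v⁆ , u~v) =
    trans (x∈p⇒∣p∣≡1+∣p-x∣ (q⊆p∪q (value A) (value B) (p─q≡⁅u⁆⇒u∈p B─A≡⁅v⁆)))
      (cong suc (trans (cong ∣_∣ A∪B-v≡A) (size A)))
    where
    A∪B-v≡A : (value A ∪ˢ value B) - v ≡ value A
    A∪B-v≡A = ⊆-antisym
      (λ {x} x∈ → [ id , (λ x∈B → p─q≡⁅u⁆⇒x≢u⇒x∈q B─A≡⁅v⁆ x∈B λ { refl → x∉p-x _ x x∈ }) ]′
        (x∈p∪q⁻ (value A) (value B) (p─q⊆p _ ⁅ v ⁆ x∈)))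
      (λ x∈A → x∈p∧x≢y⇒x∈p-y (p⊆p∪q (value B) x∈A) λ { refl → p─q≡⁅u⁆⇒u∉q B─A≡⁅v⁆ x∈A })

  remove : (Q : Subset m) → .(IsClique H Q) → ∣ Q ∣ ≡ suc k → (q : Fin m) → q ∈ Q → KClique H k
  remove Q Q-clique ∣Q∣ q q∈Q = Q - q ,
    [ (λ x y x∈ y∈ → Q-clique x y (p─q⊆p Q ⁅ q ⁆ x∈) (p─q⊆p Q ⁅ q ⁆ y∈))
    , suc-injective (trans (sym (x∈p⇒∣p∣≡1+∣p-x∣ q∈Q)) ∣Q∣) ]

  removed-adj : (Q : Subset m) → .(IsClique H Q) → {p q : Fin m} → p ∈ Q → q ∈ Q → p ≢ q →
    (A B : KClique H k) → value A ≡ Q - p → value B ≡ Q - q → Adj (TS k H) A B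
  removed-adj Q Q-clique {p} {q} p∈Q q∈Q p≢q A B refl refl =
    -- Between `Q - p` and `Q - q` the token leaves `q` and arrives at `p`, so the roles are
    -- swapped.
    q , p , p-x─p-y≡⁅y⁆ q∈Q p≢q , p-x─p-y≡⁅y⁆ p∈Q (≢-sym p≢q) ,
    recompute (adj? H q p) (Q-clique q p q∈Q p∈Q (≢-sym p≢q))

  removed-from : (Q : Subset m) → ∣ Q ∣ ≡ suc k → (A : KClique H k) → value A ⊆ Q →
    ∃[ q ] q ∈ Q × value A ≡ Q - q
  removed-from Q ∣Q∣ A A⊆Q = p⊆q∧∣q∣≡1+∣p∣⇒p≡q-x A⊆Q (trans ∣Q∣ (cong suc (sym (size A))))

  -- Each of `A`, `B` omits exactly one vertex of `Q`. If it is the same vertex they are equal;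
  -- otherwise a token slides along an edge of `Q`.
  ⊆⇒near : (Q : Subset m) → .(IsClique H Q) → ∣ Q ∣ ≡ suc k →
    (A B : KClique H k) → value A ⊆ Q → value B ⊆ Q → Near (TS k H) A B
  ⊆⇒near Q Q-clique ∣Q∣ A B A⊆Q B⊆Q
    with p , p∈Q , A≡ ← removed-from Q ∣Q∣ A A⊆Q | q , q∈Q , B≡ ← removed-from Q ∣Q∣ B B⊆Q
    with p ≟ᶠ q
  ... | yes refl = inj₁ (value-injective (trans A≡ (sym B≡)))
  ... | no  p≢q  = inj₂ (removed-adj Q Q-clique p∈Q q∈Q p≢q A B A≡ B≡)

  -- A neighbour D of A, B and X with a vertex d outside A ∪ B is contained, apart from d, in
  -- A ∩ B ∩ X; the vertices of A ─ B and B ─ A both lie in X and outside D, but X ─ D is a singleton.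
  near-flat⇒⊆ : (A B X : KClique H k) → Triangle (TS k H) A B X → value X ⊆ value A ∪ˢ value B →
    (D : KClique H k) → Near (TS k H) D A → Near (TS k H) D B → Near (TS k H) D X →
    value D ⊆ value A ∪ˢ value B
  near-flat⇒⊆ A B X _ X⊆ D (inj₁ refl) _ _ = p⊆p∪q (value B)
  near-flat⇒⊆ A B X _ X⊆ D _ (inj₁ refl) _ = q⊆p∪q (value A) (value B)
  near-flat⇒⊆ A B X _ X⊆ D _ _ (inj₁ refl) = X⊆
  near-flat⇒⊆ A B X
    ((u , v , A─B , B─A , _) , (_ , y , _ , X─A , _) , (_ , z , _ , X─B , _)) X⊆ D
    (inj₂ (a , _ , D─A , _)) (inj₂ (b , _ , D─B , _)) (inj₂ (_ , c , _ , X─D , _)) {d} d∈D =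
    decidable-stable (d ∈? _) λ d∉ →
      let d∉A = d∉ ∘ p⊆p∪q (value B)
          d∉B = d∉ ∘ q⊆p∪q (value A) (value B)
          ∈A∩B : ∀ {x} → x ∈ value D → x ≢ d → x ∈ value A × x ∈ value B
          ∈A∩B x∈D x≢d =
            p─q≡⁅u⁆⇒x≢u⇒x∈q D─A x∈D (λ x≡a → x≢d (trans x≡a (sym (p─q≡⁅u⁆⇒unique D─A d∈D d∉A)))) ,
            p─q≡⁅u⁆⇒x≢u⇒x∈q D─B x∈D (λ x≡b → x≢d (trans x≡b (sym (p─q≡⁅u⁆⇒unique D─B d∈D d∉B))))
          u∉D = λ u∈D → p─q≡⁅u⁆⇒u∉q A─B (proj₂ (∈A∩B u∈D λ { refl → d∉A (p─q≡⁅u⁆⇒u∈p A─B) }))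
          v∉D = λ v∈D → p─q≡⁅u⁆⇒u∉q B─A (proj₁ (∈A∩B v∈D λ { refl → d∉B (p─q≡⁅u⁆⇒u∈p B─A) }))
          u≡c = p─q≡⁅u⁆⇒unique X─D u∈X u∉D
          v≡c = p─q≡⁅u⁆⇒unique X─D v∈X v∉D
      in p─q≡⁅u⁆⇒u∉q B─A (subst (_∈ value A) (trans u≡c (sym v≡c)) (p─q≡⁅u⁆⇒u∈p A─B))
    where
    -- The vertex `y` of `X ─ A` lies in `B` by flatness, hence in `B ─ A`, so `y` is `v`. Likewise
    -- `z` is `u`.
    v∈X : v ∈ value X
    v∈X = let y∉A = p─q≡⁅u⁆⇒u∉q X─A ; y∈X = p─q≡⁅u⁆⇒u∈p X─A in
      [ (λ y∈A → contradiction y∈A y∉A)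
      , (λ y∈B → subst (_∈ value X) (p─q≡⁅u⁆⇒unique B─A y∈B y∉A) y∈X) ]′ (x∈p∪q⁻ _ _ (X⊆ y∈X))
    u∈X : u ∈ value X
    u∈X = let z∉B = p─q≡⁅u⁆⇒u∉q X─B ; z∈X = p─q≡⁅u⁆⇒u∈p X─B in
      [ (λ z∈A → subst (_∈ value X) (p─q≡⁅u⁆⇒unique A─B z∈A z∉B) z∈X)
      , (λ z∈B → contradiction z∈B z∉B) ]′ (x∈p∪q⁻ _ _ (X⊆ z∈X))

  -- Let `y` be the vertex of `X ─ A`. If `y ∈ B`, then `X` lies in `A` plus `y`, hence in the
  -- union. If `y ∉ B`, suppose that `c` in `A ∩ B` is missing from `X`. Then `c` is all of `B ─ X`,
  -- so `v`, which is not in `A`, lies in `X`; this forces `v = y`, although `v ∈ B`.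
  triangle-dichotomy : (A B X : KClique H k) → Triangle (TS k H) A B X →
    value X ⊆ value A ∪ˢ value B ⊎ value A ∩ value B ⊆ value X
  triangle-dichotomy A B X
    ((u , v , A─B , B─A , _) , (a , y , A─X , X─A , _) , (b , z , B─X , X─B , _))
    with y ∈? value B
  ... | yes y∈B = inj₁ λ {x} x∈X → decidable-stable (x ∈? _) λ x∉ →
    x∉ (q⊆p∪q _ _ (subst (_∈ value B)
      (sym (p─q≡⁅u⁆⇒unique X─A x∈X (x∉ ∘ p⊆p∪q (value B)))) y∈B))
  ... | no y∉B = inj₂ λ {c} c∈ → let c∈A , c∈B = x∈p∩q⁻ _ _ c∈ in
    decidable-stable (c ∈? _) λ c∉X →
      let v∈B = p─q≡⁅u⁆⇒u∈p B─A
          v∉A = p─q≡⁅u⁆⇒u∉q B─A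
          v∈X = decidable-stable (v ∈? _) λ v∉X → v∉A (subst (_∈ value A)
            (trans (p─q≡⁅u⁆⇒unique B─X c∈B c∉X) (sym (p─q≡⁅u⁆⇒unique B─X v∈B v∉X))) c∈A)
      in y∉B (subst (_∈ value B) (p─q≡⁅u⁆⇒unique X─A v∈X v∉A) v∈B)

  ∃-flat-triangle : (Q : Subset m) → .(IsClique H Q) → ∣ Q ∣ ≡ suc k → 2 ≤ k →
    ∃[ A ] ∃[ B ] ∃[ X ] Triangle (TS k H) A B X × value X ⊆ value A ∪ˢ value B
  -- From `2 ≤ k` the clique `Q` has at least three vertices, so three can be picked in turn.
  ∃-flat-triangle Q Q-clique ∣Q∣ (s≤s (s≤s _))
    with x , x∈Q ← ∣p∣≡1+k⇒Nonempty Q ∣Q∣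
    with ∣Q-x∣ ← suc-injective (trans (sym (x∈p⇒∣p∣≡1+∣p-x∣ x∈Q)) ∣Q∣)
    with y , y∈Q-x ← ∣p∣≡1+k⇒Nonempty (Q - x) ∣Q-x∣
    with ∣Q-x-y∣ ← suc-injective (trans (sym (x∈p⇒∣p∣≡1+∣p-x∣ y∈Q-x)) ∣Q-x∣)
    with z , z∈Q-x-y ← ∣p∣≡1+k⇒Nonempty (Q - x - y) ∣Q-x-y∣
    =
    Q-x , Q-y , Q-z ,
    ( removed-adj Q Q-clique x∈Q y∈Q x≢y Q-x Q-y refl refl
    , removed-adj Q Q-clique x∈Q z∈Q x≢z Q-x Q-z refl refl
    , removed-adj Q Q-clique y∈Q z∈Q y≢z Q-y Q-z refl refl ) ,
    λ {w} w∈ → covered w (p─q⊆p Q ⁅ z ⁆ w∈)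
    where
    y∈Q = p─q⊆p Q ⁅ x ⁆ y∈Q-x
    z∈Q-x = p─q⊆p (Q - x) ⁅ y ⁆ z∈Q-x-y
    z∈Q = p─q⊆p Q ⁅ x ⁆ z∈Q-x
    Q-x = remove Q Q-clique ∣Q∣ x x∈Q
    Q-y = remove Q Q-clique ∣Q∣ y y∈Q
    Q-z = remove Q Q-clique ∣Q∣ z z∈Q
    x≢y : x ≢ y
    x≢y refl = x∉p-x Q x y∈Q-x
    x≢z : x ≢ z
    x≢z refl = x∉p-x Q x z∈Q-x
    y≢z : y ≢ z
    y≢z refl = x∉p-x (Q - x) y z∈Q-x-y
    -- `Q - x` and `Q - y` together already cover `Q`, because `x` itself lies in `Q - y`.
    covered : ∀ w → w ∈ Q → w ∈ (Q - x) ∪ˢ (Q - y)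
    covered w w∈Q with w ≟ᶠ x
    ... | yes refl = q⊆p∪q _ _ (x∈p∧x≢y⇒x∈p-y w∈Q x≢y)
    ... | no  w≢x  = p⊆p∪q _ (x∈p∧x≢y⇒x∈p-y w∈Q w≢x)

module _ {k l : ℕ} (H : SimpleGraph (Fin m)) (H′ : SimpleGraph (Fin n)) where

  -- Injects the `k + 1` vertices of `A ∪ B` into the `l + 1` vertices of `A′ ∪ B′`. The images are
  -- separate variables with equations so that the lemma also applies to the inverse isomorphism,
  -- where `from φ (to φ A)` equals `A` only propositionally.
  flat-triangle⇒≤ : (φ : TS k H ≅ TS l H′)
    (A B X : KClique H k) → Triangle (TS k H) A B X → value X ⊆ value A ∪ˢ value B →
    (A′ B′ X′ : KClique H′ l) → to φ A ≡ A′ → to φ B ≡ B′ → to φ X ≡ X′ →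
    value X′ ⊆ value A′ ∪ˢ value B′ → k ≤ l
  flat-triangle⇒≤ φ A B X (A~B , A~X , B~X) X⊆ A′ B′ X′ refl refl refl X′⊆ =
    s≤s⁻¹ (subst₂ _≤_ ∣U∣ ∣U′∣ (relation⇒∣p∣≤∣q∣ U U′ R total injective))
    where
    U = value A ∪ˢ value B
    U′ = value A′ ∪ˢ value B′
    U-clique = ∪-clique H A B A~B
    ∣U∣ = ∪-size H A B A~B
    ∣U′∣ = ∪-size H′ A′ B′ (to-adj φ A~B)
    -- `R q q′` says that `φ` takes `U - q` to `U′ - q′`. The condition `q ∈ U` is what makes
    -- different `q` give different sets `U - q`.
    R : Fin m → Fin n → Set
    R q q′ = q ∈ U × ∃[ D ] value D ≡ U - q × value (to φ D) ≡ U′ - q′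
    to-near : ∀ {D E} → Near (TS k H) D E → Near (TS l H′) (to φ D) (to φ E)
    to-near = ⊎-map (cong (to φ)) (to-adj φ)
    near : ∀ D → value D ⊆ U → ∀ E → value E ⊆ U → Near (TS l H′) (to φ D) (to φ E)
    near D D⊆ E E⊆ = to-near (⊆⇒near H U U-clique ∣U∣ D E D⊆ E⊆)
    total : ∀ {q} → q ∈ U → ∃[ q′ ] q′ ∈ U′ × R q q′
    total {q} q∈U =
      -- The clique `U - q` is near `A`, `B` and `X`, since all lie in `U`. Hence its image is near
      -- `A′`, `B′` and `X′`, and flatness of that triangle confines it to `U′`.
      let D = remove H U U-clique ∣U∣ q q∈U
          D⊆U = p─q⊆p U ⁅ q ⁆
          D′⊆U′ = near-flat⇒⊆ H′ A′ B′ X′ (to-adj φ A~B , to-adj φ A~X , to-adj φ B~X) X′⊆ (to φ D)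
            (near D D⊆U A (p⊆p∪q (value B))) (near D D⊆U B (q⊆p∪q (value A) (value B))) (near D D⊆U X X⊆)
          q′ , q′∈U′ , D′≡ = removed-from H′ U′ ∣U′∣ (to φ D) D′⊆U′
      in q′ , q′∈U′ , q∈U , D , refl , D′≡
    injective : ∀ {p q q′} → R p q′ → R q q′ → p ≡ q
    injective {p} {q} (p∈U , D , D≡ , φD≡) (q∈U , E , E≡ , φE≡) =
      decidable-stable (p ≟ᶠ q) λ p≢q → x∉p-x U p
        (subst (p ∈_) (trans (sym E≡) (trans (cong value E≡D) D≡)) (x∈p∧x≢y⇒x∈p-y p∈U p≢q))
      where
      E≡D : E ≡ D
      E≡D = trans (sym (from∘to φ E))
        (trans (cong (from φ) (value-injective (trans φE≡ (sym φD≡)))) (from∘to φ D))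

flat-triangle⇒≡ : (H : SimpleGraph (Fin m)) (H′ : SimpleGraph (Fin n)) (φ : TS k H ≅ TS l H′)
  (A B X : KClique H k) → Triangle (TS k H) A B X → value X ⊆ value A ∪ˢ value B →
  value (to φ X) ⊆ value (to φ A) ∪ˢ value (to φ B) → k ≡ l
flat-triangle⇒≡ H H′ φ A B X t@(A~B , A~X , B~X) X⊆ X′⊆ = ≤-antisym
  (flat-triangle⇒≤ H H′ φ A B X t X⊆ _ _ _ refl refl refl X′⊆)
  (flat-triangle⇒≤ H′ H (≅-sym φ) _ _ _ (to-adj φ A~B , to-adj φ A~X , to-adj φ B~X) X′⊆
    A B X (from∘to φ A) (from∘to φ B) (from∘to φ X) X⊆)

TS₁≅ : (H : SimpleGraph (Fin m)) → TS 1 H ≅ H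
TS₁≅ {m} H = record
  { bijection = mk↔ₛ′ token single
      (λ x → sym (x∈⁅y⁆⇒x≡y (token (single x)) (subst (x ∈_) (value≡⁅token⁆ (single x)) (x∈⁅x⁆ x))))
      (λ A → value-injective (sym (value≡⁅token⁆ A)))
  ; adj⇔      = λ A B → mk⇔
      (λ (u , v , A─B , B─A , u~v) → subst₂ (Adj H)
        (token-unique A (p─q≡⁅u⁆⇒u∈p A─B)) (token-unique B (p─q≡⁅u⁆⇒u∈p B─A)) u~v)
      (λ a~b → token A , token B , disjoint A B a~b , disjoint B A (adj-sym H a~b) , a~b)
  }
  where
  singleton : (A : KClique H 1) → ∃[ x ] value A ≡ ⁅ x ⁆
  singleton A = ∣p∣≡1⇒singleton (value A) (size A)
  token : KClique H 1 → Fin m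
  token = proj₁ ∘ singleton
  value≡⁅token⁆ : ∀ A → value A ≡ ⁅ token A ⁆
  value≡⁅token⁆ = proj₂ ∘ singleton
  single : Fin m → KClique H 1
  single x = ⁅ x ⁆ , [ (λ y z y∈ z∈ y≢z →
    contradiction (trans (x∈⁅y⁆⇒x≡y x y∈) (sym (x∈⁅y⁆⇒x≡y x z∈))) y≢z) , ∣⁅x⁆∣≡1 x ]
  token-unique : ∀ A {x} → x ∈ value A → x ≡ token A
  token-unique A x∈A = x∈⁅y⁆⇒x≡y (token A) (subst (_ ∈_) (value≡⁅token⁆ A) x∈A)
  token∈ : ∀ A → token A ∈ value A
  token∈ A = subst (token A ∈_) (sym (value≡⁅token⁆ A)) (x∈⁅x⁆ (token A))
  disjoint : ∀ A B → Adj H (token A) (token B) → value A ─ value B ≡ ⁅ token A ⁆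
  disjoint A B a~b = p─q≡⁅u⁆⁺ (token∈ A)
    (λ a∈B → adj-irrefl H (token B) (subst (λ x → Adj H x (token B)) (token-unique B a∈B) a~b))
    (λ x∈A _ → token-unique A x∈A)

-- A numbering of the vertices transports `G` to a graph on `Fin m`, and `TS 1` reproduces that
-- graph.
1∈𝒦ᵀˢ : {V : Set} (G : SimpleGraph V) → V ↔ Fin m → 𝒦ᵀˢ G 1
1∈𝒦ᵀˢ {m} G f = s≤s z≤n , m , H , ≅-trans (TS₁≅ H)
  record { bijection = ↔-sym f ; adj⇔ = λ x y → mk⇔ id id }
  where
  g = Inverse.from f
  H : SimpleGraph (Fin m)
  H = record
    { Adj        = λ x y → Adj G (g x) (g y)
    ; adj?       = λ x y → adj? G (g x) (g y)
    ; adj-sym    = adj-sym G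
    ; adj-irrefl = λ x → adj-irrefl G (g x)
    }

-- Johnson graphs

complete-clique : (S : Subset n) → IsClique (complete n) S
complete-clique S x y _ _ x≢y = x≢y

-- In a complete graph every set is a clique and any two distinct vertices allow a slide. Since
-- `∣ A ─ B ∣ + ∣ A ∩ B ∣` is `r`, the Johnson condition says exactly that the differences are
-- singletons.
TS-complete≅Johnson : (n r : ℕ) → TS r (complete n) ≅ Johnson n r
TS-complete≅Johnson n r = record
  { bijection = mk↔ₛ′ (λ (S , [ p ]) → S , [ proj₂ p ]) (λ (S , [ p ]) → S , [ complete-clique S , p ])
                      (λ _ → refl) (λ _ → refl)
  ; adj⇔      = λ A B → mk⇔
      (λ (u , v , A─B , _) → trans
        (cong (_+ ∣ value A ∩ value B ∣) (sym (trans (cong ∣_∣ A─B) (∣⁅x⁆∣≡1 u))))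
        (trans (∣p─q∣+∣p∩q∣≡∣p∣ (value A) (value B)) (size A)))
      (λ e → let u , A─B = difference A B e
                 v , B─A = difference B A (trans (cong (suc ∘ ∣_∣) (∩-comm (value B) (value A))) e)
             in u , v , A─B , B─A ,
                λ u≡v → p─q≡⁅u⁆⇒u∉q A─B (subst (_∈ value B) (sym u≡v) (p─q≡⁅u⁆⇒u∈p B─A)))
  }
  where
  difference : (A B : KClique (complete n) r) → suc ∣ value A ∩ value B ∣ ≡ r →
               ∃[ u ] value A ─ value B ≡ ⁅ u ⁆
  difference A B e = ∣p∣≡1⇒singleton _ (+-cancelʳ-≡ ∣ value A ∩ value B ∣ _ 1
    (trans (∣p─q∣+∣p∩q∣≡∣p∣ (value A) (value B)) (trans (size A) (sym e))))

-- Complementation exchanges `A ─ B` and `B ─ A`, so the same slide is made in the opposite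
-- direction.
TS-complete-∁ : {r : ℕ} → r ≤ n → TS r (complete n) ≅ TS (n ∸ r) (complete n)
TS-complete-∁ {n} {r} r≤n = record
  { bijection = mk↔ₛ′
      (λ A → ∁ (value A) , [ complete-clique _ , trans (∣∁p∣≡n∸∣p∣ (value A)) (cong (n ∸_) (size A)) ])
      (λ A → ∁ (value A) , [ complete-clique _ ,
        trans (∣∁p∣≡n∸∣p∣ (value A)) (trans (cong (n ∸_) (size A)) (m∸[m∸n]≡n r≤n)) ])
      (λ A → value-injective (∁-involutive (value A)))
      (λ A → value-injective (∁-involutive (value A)))
  ; adj⇔      = λ A B → mk⇔
      (λ (u , v , A─B , B─A , u≢v) →
        v , u , trans (∁p─∁q≡q─p _ _) B─A , trans (∁p─∁q≡q─p _ _) A─B , ≢-sym u≢v)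
      (λ (u , v , A─B , B─A , u≢v) →
        v , u , trans (sym (∁p─∁q≡q─p _ _)) B─A , trans (sym (∁p─∁q≡q─p _ _)) A─B , ≢-sym u≢v)
  }

-- As `r < n` there is a set of `r + 1` elements, and as `1 ≤ r` two different ones can be deleted
-- from it.
TS-complete-edge : {r : ℕ} → 1 ≤ r → r < n →
  ∃[ A ] ∃[ B ] Adj (TS r (complete n)) A B
TS-complete-edge {r = r} (s≤s _) r<n
  with Q , ∣Q∣ ← ∃-∣p∣≡k r<n
  with x , x∈Q ← ∣p∣≡1+k⇒Nonempty Q ∣Q∣
  with y , y∈Q-x ← ∣p∣≡1+k⇒Nonempty (Q - x) (suc-injective (trans (sym (x∈p⇒∣p∣≡1+∣p-x∣ x∈Q)) ∣Q∣))
  with y∈Q ← p─q⊆p Q ⁅ x ⁆ y∈Q-x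
  = let A = remove (complete _) Q (complete-clique Q) ∣Q∣ x x∈Q
        B = remove (complete _) Q (complete-clique Q) ∣Q∣ y y∈Q
    in A , B ,
       removed-adj (complete _) Q (complete-clique Q) x∈Q y∈Q (λ { refl → x∉p-x Q x y∈Q-x }) A B refl refl

TS≅Johnson⇒ : {r : ℕ} (H : SimpleGraph (Fin m)) → 2 ≤ k → 1 ≤ r → r < n →
  TS k H ≅ Johnson n r → k ≡ r ⊎ k ≡ n ∸ r
TS≅Johnson⇒ {n = n} {r = r} H 2≤k 1≤r r<n iso
  with φ ← ≅-trans iso (≅-sym (TS-complete≅Johnson n r))
  with A′ , B′ , A′~B′ ← TS-complete-edge 1≤r r<n
  with e ← to-adj (≅-sym φ) {A′} {B′} A′~B′
  with A , B , X , t@(A~B , A~X , B~X) , X⊆ ← ∃-flat-triangle H _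
         (∪-clique H (from φ A′) (from φ B′) e) (∪-size H (from φ A′) (from φ B′) e) 2≤k
  with triangle-dichotomy (complete n) (to φ A) (to φ B) (to φ X)
         (to-adj φ {A} {B} A~B , to-adj φ {A} {X} A~X , to-adj φ {B} {X} B~X)
... | inj₁ X′⊆ = inj₁ (flat-triangle⇒≡ H (complete n) φ A B X t X⊆ X′⊆)
... | inj₂ ⊆X′ =
  -- After complementing, the triangle is flat: a point outside `∁ A′` and `∁ B′` lies in `A′ ∩ B′`,
  -- hence in `X′`, so not in `∁ X′`. Here `A′`, `B′`, `X′` are the images of `A`, `B`, `X` under
  -- `φ`.
  inj₂ (flat-triangle⇒≡ H (complete n) (≅-trans φ (TS-complete-∁ (<⇒≤ r<n))) A B X t X⊆ λ {x} x∈ →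
    decidable-stable (x ∈? _) λ x∉ → x∈∁p⇒x∉p x∈ (⊆X′ (x∈p∩q⁺
      ( x∉∁p⇒x∈p (x∉ ∘ p⊆p∪q _) , x∉∁p⇒x∈p (x∉ ∘ q⊆p∪q _ _)))))

-- One formula for all cases; the cases of the theorem only record which of `1`, `r` and `n ∸ r`
-- coincide.
𝒦ᵀˢ-Johnson : (n r : ℕ) → 1 ≤ r → r < n → 𝒦ᵀˢ (Johnson n r) ≐ ｛ 1 ｝ ∪ ｛ r ｝ ∪ ｛ n ∸ r ｝
𝒦ᵀˢ-Johnson n r 1≤r r<n = ⇒ , ⇐
  where
  ⇒ : ∀ {k} → 𝒦ᵀˢ (Johnson n r) k → 1 ≡ k ⊎ r ≡ k ⊎ n ∸ r ≡ k
  ⇒ (s≤s {n = zero}  _ , _) = inj₁ refl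
  ⇒ (s≤s {n = suc _} _ , _ , H , iso) =
    inj₂ (⊎-map sym sym (TS≅Johnson⇒ H (s≤s (s≤s z≤n)) 1≤r r<n iso))
  ⇐ : ∀ {k} → 1 ≡ k ⊎ r ≡ k ⊎ n ∸ r ≡ k → 𝒦ᵀˢ (Johnson n r) k
  ⇐ (inj₁ refl)        = 1∈𝒦ᵀˢ (Johnson n r) (proj₂ (subsets-finite (λ S → ∣ S ∣ ≟ r)))
  ⇐ (inj₂ (inj₁ refl)) = 1≤r , n , complete n , TS-complete≅Johnson n r
  ⇐ (inj₂ (inj₂ refl)) = m<n⇒0<n∸m r<n , n , complete n ,
    ≅-trans (≅-sym (TS-complete-∁ (<⇒≤ r<n))) (TS-complete≅Johnson n r)

𝒦ᵀˢ-Johnson-⊓ : (n r : ℕ) → 1 ≤ r → r < n → let s = r ⊓ (n ∸ r) in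
  𝒦ᵀˢ (Johnson n r) ≐ ｛ 1 ｝ ∪ ｛ s ｝ ∪ ｛ n ∸ s ｝
𝒦ᵀˢ-Johnson-⊓ n r 1≤r r<n with ≤-total r (n ∸ r) | 𝒦ᵀˢ-Johnson n r 1≤r r<n
... | inj₁ r≤n∸r | 𝒦≐ rewrite m≤n⇒m⊓n≡m r≤n∸r = 𝒦≐
-- Now `s` is `n ∸ r` and `n ∸ s` is `r`, so the last two members change places.
... | inj₂ n∸r≤r | ⇒ , ⇐ rewrite m≥n⇒m⊓n≡n n∸r≤r | m∸[m∸n]≡n (<⇒≤ r<n) =
  ⊎-map id swap ∘ ⇒ , ⇐ ∘ ⊎-map id swap

theorem3p10 : (n r : ℕ) → 2 ≤ n → 1 ≤ r → r ≤ n ∸ 1 →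
    let s = r ⊓ (n ∸ r) in
    (n ≡ 2 → 𝒦ᵀˢ (Johnson n r) ≐ ｛ 1 ｝)
    × (3 ≤ n → s ≡ 1 → 𝒦ᵀˢ (Johnson n r) ≐ ｛ 1 ｝ ∪ ｛ n ∸ 1 ｝)
    × (2 ≤ s → n ≡ 2 * s → 𝒦ᵀˢ (Johnson n r) ≐ ｛ 1 ｝ ∪ ｛ s ｝)
    × (2 ≤ s → 2 * s < n → 𝒦ᵀˢ (Johnson n r) ≐ ｛ 1 ｝ ∪ ｛ s ｝ ∪ ｛ n ∸ s ｝)
theorem3p10 n@(suc _) r 2≤n 1≤r r≤n∸1 =
  -- For `n = 2` the bounds force `r = 1`, and then `n ∸ r` is `1` as well.
  (λ { refl → let r≡1 = ≤-antisym r≤n∸1 1≤r in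
       (λ k∈ → [ id , [ trans (sym r≡1) , trans (cong (2 ∸_) (sym r≡1)) ]′ ]′ (proj₁ 𝒦≐ʳ k∈)) ,
       (λ 1≡k → proj₂ 𝒦≐ʳ (inj₁ 1≡k)) }) ,
  (λ _ s≡1 →
       (λ k∈ → [ inj₁ , [ inj₁ ∘ trans (sym s≡1) , inj₂ ∘ trans (cong (n ∸_) (sym s≡1)) ]′ ]′ (proj₁ 𝒦≐ k∈)) ,
       (λ k∈ → proj₂ 𝒦≐ (⊎-map id (inj₂ ∘ trans (cong (n ∸_) s≡1)) k∈))) ,
  (λ _ n≡2s →
       (λ k∈ → ⊎-map id [ id , trans (sym (n∸s≡s n≡2s)) ]′ (proj₁ 𝒦≐ k∈)) ,
       (λ k∈ → proj₂ 𝒦≐ (⊎-map id inj₁ k∈))) ,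
  (λ _ _ → 𝒦≐)
  where
  s = r ⊓ (n ∸ r)
  𝒦≐ʳ = 𝒦ᵀˢ-Johnson n r 1≤r (s≤s r≤n∸1)
  𝒦≐ = 𝒦ᵀˢ-Johnson-⊓ n r 1≤r (s≤s r≤n∸1)
  n∸s≡s : n ≡ 2 * s → n ∸ s ≡ s
  n∸s≡s n≡2s = trans (cong (_∸ s) n≡2s) (trans (m+n∸m≡n s (s + 0)) (+-identityʳ s))
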